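{- Let $p\ge1$ be an integer. For every quarter-plane $p$-tandem walk $\bar w\in\mathcal T_p$, the raising algorithm and the RL transducer algorithm, both applied to $\bar w$, produce the same output word in $\Sigma_p^*$; that is, the output of the raising algorithm on $\bar w$ is $\Psi_p(\bar w)$.
   Context: Fix an integer $p\ge1$; $\mathbb N$ contains $0$; $A^*$ is the set of finite words on $A$, with empty word $\epsilon$; $|w|$ is the length of a word. Alphabets: $\Sigma_p=\{ -1,0,1,\dots,p\}$; $S_p=\{(-j,p-j):0\le j\le p\}\cup\{(1,-1)\}\subset\mathbb Z^2$; $A_p=\{a_{\ell,m}:\ell,m\in\mathbb N,\ 0\le\ell+m\le p-1\}$ (formal letters). $\mathcal T_p$ is the set of words $\bar w\in S_p^*$ such that for every prefix the sum of its letters lies in $\mathbb N^2$. Transitions, written $\mu;\ (H_L,v_L)\to(H_R,v_R);\ \bar a$ with $\mu\in\Sigma_p$, $(H_L,v_L),(H_R,v_R)\in A_p^*\times\mathbb N$, $\bar a\in S_p$, and arbitrary $\Lambda\in A_p^*$, $\beta\in\mathbb N$, $a_{\ell,m}\in A_p$: (T1) $p;\ (\Lambda,\beta)\to(\Lambda,\beta+p);\ (0,p)$. (T2) $q;\ (\Lambda,0)\to(\Lambda,q);\ (0,p)$, for $0\le q\le p-1$. (T3) $-1;\ (\Lambda a_{\ell,m},0)\to(\Lambda,\ell);\ (-m-1,p-m-1)$, for $\ell+m\le p-1$. (T4) $-1;\ (\Lambda a_{\ell,m},\beta+1)\to(\Lambda,\beta+\ell+1);\ (-m-1,p-m-1)$,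 for $\ell+m=p-1$. (T5) $q;\ (\Lambda,\beta+1)\to(\Lambda a_{q,0},\beta);\ (1,-1)$, for $0\le q\le p-1$. (T6) $-1;\ (\Lambda a_{\ell,m},\beta+1)\to(\Lambda a_{\ell,m+1},\beta);\ (1,-1)$, for $\ell+m\le p-2$. (T7) $-1;\ (\epsilon,\beta+1)\to(\epsilon,\beta);\ (1,-1)$. Each triple $(H_R,v_R,\bar a)\in A_p^*\times\mathbb N\times S_p$ matches the right side of exactly one of these and determines $(\mu,H_L,v_L)$. RL transducer algorithm ($\Psi_p$): given $\bar w=\bar a_1\cdots\bar a_n\in S_p^*$, start with $(H_n,v_n)=(\epsilon,0)$; for $i=n,n-1,\dots,1$ apply in reverse the unique transition matching $(H_i,v_i,\bar a_i)$ to get $w_i\in\Sigma_p$ and $(H_{i-1},v_{i-1})$. The output is $\Psi_p(\bar w)=w_1\cdots w_n$. Raising algorithm. It uses decorated letters $(\mu)^{j,t}$ with $\mu\in\Sigma_p$, an integer $j\ge0$ (the raisability) and an integer $t\ge-1$ (the modality). Input: $\bar a_1\cdots\bar a_n\in\mathcal T_p$. Set $L_0=\epsilon$. For $i=1,\dots,n$ define $L_i$ (a word of length $i$ in decorated letters) from $L_{i-1}$ and $\bar a_i$: (a) If $\bar a_i=(0,p)$, then $L_i=L_{i-1}\,(0)^{p,0}$. (b) If $\bar a_i=(1,-1)$, write $L_{i-1}=w\,(\mu)^{j,t}\,w'$ with $j>0$, $t\ge0$ and $w'$ having no letter with both raisability $>0$ and modality $\ge0$. If $t=0$, then $L_i=w\,(\mu+1)^{j-1,0}\,w'\,(-1)^{1,-1}$.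 If $t>0$, rewrite $L_{i-1}=w''\,(\mu')^{0,-1}\,w'''\,(\mu)^{j,t}\,w'$ with $|w'''|=t-1$ and set $L_i=w''\,(\mu'+1)^{0,-1}\,w'''\,(\mu)^{j-1,t}\,w'\,(-1)^{1,-1}$. (c) If $\bar a_i=(-m,p-m)$ with $1\le m\le p$, write $L_{i-1}=w_0\,(\mu_1)^{j_1,-1}\,w_1\,(\mu_2)^{j_2,-1}\,w_2\cdots w_{m-1}\,(\mu_m)^{j_m,-1}\,w_m$ where for each $\ell\in\{1,\dots,m\}$, $j_\ell>0$ and $w_\ell$ has no letter with both raisability $>0$ and modality $-1$; then set $L_i=w_0\,(\mu_1+1)^{0,-1}\,w_1\,(\mu_2)^{0,-1}\,w_2\cdots w_{m-1}\,(\mu_m)^{0,-1}\,w_m\,(-1)^{p-m,d}$ where $d=i-1-|w_0|$. Finally, replace each decorated letter $(\mu)^{j,t}$ of $L_n$ by $\mu$ and return the resulting word. (For inputs in $\mathcal T_p$ the required factorizations exist.) -}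

module Defs where

open import Data.Integer.Base as ℤ using (ℤ; +_; -[1+_]; 0ℤ; 1ℤ; -1ℤ)
open import Data.List.Base using (List; []; _∷_; _++_; [_]; length; map; concatMap; foldr)
open import Data.List.Relation.Unary.All using (All)
open import Data.Nat.Base using (ℕ; zero; suc; _+_; _∸_; _≤_; _<_; z≤n; s≤s)
open import Data.Nat.Properties
open import Data.Product.Base using (_×_; _,_; ∃-syntax; proj₁)
open import Relation.Binary.PropositionalEquality using (_≡_; refl; sym; trans; cong; subst)
open import Relation.Nullary using (¬_; yes; no; contradiction)
open import Relation.Nullary.Decidable using (recompute)

------------------------------------------------------------------------
-- Alphabets

-- Σ_p = {-1, 0, 1, …, p}.
data Symbol (p : ℕ) : Set where
  minus : Symbol p
  nat   : (q : ℕ) → .(q ≤ p) → Symbol p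

value : ∀ {p} → Symbol p → ℤ
value minus     = -1ℤ
value (nat q _) = + q

-- S_p, with nw j = (-j, p-j) and se = (1, -1).
data Step (p : ℕ) : Set where
  nw : (j : ℕ) → .(j ≤ p) → Step p
  se : Step p

vec : ∀ {p} → Step p → ℤ × ℤ
vec {p} (nw j _) = ℤ.- (+ j) , + p ℤ.- + j
vec     se       = 1ℤ , -1ℤ

-- A_p.  For p ≥ 1, the condition ℓ + m < p is ℓ + m ≤ p - 1.
data Stored (p : ℕ) : Set where
  a : (ℓ m : ℕ) → .(ℓ + m < p) → Stored p

------------------------------------------------------------------------
-- Quarter-plane tandem walks

_⊕_ : ℤ × ℤ → ℤ × ℤ → ℤ × ℤ
(x , y) ⊕ (x′ , y′) = (x ℤ.+ x′) , (y ℤ.+ y′)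

endpoint : ∀ {p} → List (Step p) → ℤ × ℤ
endpoint = foldr (λ s e → vec s ⊕ e) (0ℤ , 0ℤ)

InQuadrant : ℤ × ℤ → Set
InQuadrant (x , y) = 0ℤ ℤ.≤ x × 0ℤ ℤ.≤ y

IsTandemWalk : ∀ {p} → List (Step p) → Set
IsTandemWalk w = ∀ u v → w ≡ u ++ v → InQuadrant (endpoint u)

------------------------------------------------------------------------
-- RL transducer

-- The word in A_p* is stored as a stack, i.e. with its last letter first:
-- Λ a_{ℓ,m} is a ℓ m _ ∷ Λ.
Config : ℕ → Set
Config p = List (Stored p) × ℕ

data Transition {p : ℕ} : Symbol p → Config p → Config p → Step p → Set where
  T1 : ∀ {Λ β} →
       Transition (nat p ≤-refl) (Λ , β) (Λ , β + p) (nw 0 z≤n)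
  T2 : ∀ {Λ q} (q<p : q < p) →
       Transition (nat q (<⇒≤ q<p)) (Λ , 0) (Λ , q) (nw 0 z≤n)
  T3 : ∀ {Λ ℓ m} (b : ℓ + m < p) .(c : suc m ≤ p) →
       Transition minus (a ℓ m b ∷ Λ , 0) (Λ , ℓ) (nw (suc m) c)
  T4 : ∀ {Λ β ℓ m} (e : suc (ℓ + m) ≡ p) .(c : suc m ≤ p) →
       Transition minus (a ℓ m (≤-reflexive e) ∷ Λ , suc β)
                        (Λ , suc (β + ℓ)) (nw (suc m) c)
  T5 : ∀ {Λ β q} .(q≤p : q ≤ p) .(b : q + 0 < p) →
       Transition (nat q q≤p) (Λ , suc β) (a q 0 b ∷ Λ , β) se
  T6 : ∀ {Λ β ℓ m} .(b : ℓ + m < p) .(c : ℓ + suc m < p) →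
       Transition minus (a ℓ m b ∷ Λ , suc β) (a ℓ (suc m) c ∷ Λ , β) se
  T7 : ∀ {β} →
       Transition minus ([] , suc β) ([] , β) se

private
  top-bound : ∀ {p m} → suc m ≤ p → suc ((p ∸ suc m) + m) ≡ p
  top-bound {p} {m} c =
    trans (sym (+-suc (p ∸ suc m) m)) (m∸n+n≡m c)

-- The unique transition with a given right side, applied in reverse.
back : ∀ {p} → Config p → Step p → Symbol p × Config p
back {p} (Λ , v) (nw zero _) with p ≤? v
... | yes _  = nat p ≤-refl , Λ , v ∸ p
... | no p≰v = nat v (≰⇒≥ p≰v) , Λ , 0
back {p} (Λ , v) (nw (suc m) c) with v + m <? p
... | yes b = minus , a v m b ∷ Λ , 0
... | no _  = minus , a (p ∸ suc m) m (≤-reflexive (top-bound c)) ∷ Λ , v ∸ (p ∸ suc m)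
back (a q zero b ∷ Λ , v)    se = nat q (≤-trans (m≤m+n q 0) (<⇒≤ b)) , Λ , suc v
back (a ℓ (suc m) b ∷ Λ , v) se = minus , a ℓ m (≤-<-trans (+-monoʳ-≤ ℓ (n≤1+n m)) b) ∷ Λ , suc v
back ([] , v)                se = minus , [] , suc v

back-sound : ∀ {p} (c : Config p) (s : Step p) →
             let (μ , c′) = back c s in Transition μ c′ c s
back-sound {p} (Λ , v) (nw zero _) with p ≤? v
... | yes p≤v = subst (λ x → Transition (nat p ≤-refl) (Λ , v ∸ p) (Λ , x) (nw 0 z≤n)) (m∸n+n≡m p≤v) T1
... | no p≰v  = T2 (≰⇒> p≰v)
back-sound {p} (Λ , v) (nw (suc m) c) with v + m <? p
... | yes b = T3 b c
... | no ¬b = lemma (v ∸ ℓ) refl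
  where
  c′ = recompute (suc m ≤? p) c
  ℓ = p ∸ suc m
  ℓ<v : ℓ < v
  ℓ<v = +-cancelʳ-< m ℓ v (≤-trans (≤-reflexive (top-bound c′)) (≮⇒≥ ¬b))
  lemma : ∀ d → v ∸ ℓ ≡ d → Transition minus (a ℓ m (≤-reflexive (top-bound c)) ∷ Λ , d) (Λ , v) (nw (suc m) c)
  lemma zero    eq = contradiction (m∸n≡0⇒m≤n eq) (<⇒≱ ℓ<v)
  lemma (suc β) eq =
    subst (λ x → Transition minus (a ℓ m (≤-reflexive (top-bound c)) ∷ Λ , suc β) (Λ , x) (nw (suc m) c))
          (trans (cong (_+ ℓ) (sym eq)) (m∸n+n≡m (<⇒≤ ℓ<v)))
          (T4 (top-bound c′) c)
back-sound (a q zero b ∷ Λ , v)    se = T5 (≤-trans (m≤m+n q 0) (<⇒≤ b)) b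
back-sound (a ℓ (suc m) b ∷ Λ , v) se = T6 (≤-<-trans (+-monoʳ-≤ ℓ (n≤1+n m)) b) b
back-sound ([] , v)                se = T7

back-unique : ∀ {p μ} {c c′ : Config p} {s} →
              Transition μ c′ c s → back c s ≡ (μ , c′)
back-unique {p} (T1 {Λ} {β}) with p ≤? β + p
... | yes _  = cong (λ x → nat p ≤-refl , Λ , x) (m+n∸n≡m β p)
... | no p≰  = contradiction (m≤n+m p β) p≰
back-unique {p} (T2 {Λ} {q} q<p) with p ≤? q
... | yes p≤q = contradiction p≤q (<⇒≱ q<p)
... | no _    = refl
back-unique {p} (T3 {Λ} {ℓ} {m} b c) with ℓ + m <? p
... | yes _ = refl
... | no ¬b = contradiction b ¬b
back-unique {p} (T4 {Λ} {β} {ℓ} {m} refl c) with suc (β + ℓ) + m <? p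
... | yes b = contradiction b (≤⇒≯ (s≤s (+-monoˡ-≤ m (m≤n+m ℓ β))))
... | no _  = lemma _ (m+n∸n≡m ℓ m)
  where
  lemma : ∀ {x} .(b : x + m < p) (e : x ≡ ℓ) →
          _≡_ {A = Symbol p × Config p}
              (minus , a x m b ∷ Λ , suc (β + ℓ) ∸ x) (minus , a ℓ m ≤-refl ∷ Λ , suc β)
  lemma _ refl = cong (λ v → minus , a ℓ m ≤-refl ∷ Λ , v) (m+n∸n≡m (suc β) ℓ)
back-unique (T5 _ _) = refl
back-unique (T6 _ _) = refl
back-unique T7       = refl

runRL : ∀ {p} → List (Step p) → List (Symbol p) × Config p
runRL []      = [] , [] , 0
runRL (s ∷ w) =
  let (u , c)  = runRL w
      (μ , c′) = back c s
  in μ ∷ u , c′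

Ψ : ∀ {p} → List (Step p) → List (Symbol p)
Ψ w = proj₁ (runRL w)

------------------------------------------------------------------------
-- Raising algorithm

-- Integers ≥ -1.
data Modality : Set where
  -1ₘ : Modality
  +ₘ_ : ℕ → Modality

-- deco μ j t is (μ)^{j,t}.
record Decorated (p : ℕ) : Set where
  constructor deco
  field
    symbol       : Symbol p
    raisability  : ℕ
    modality     : Modality
open Decorated public

_isSuccOf_ : ∀ {p} → Symbol p → Symbol p → Set
μ⁺ isSuccOf μ = value μ⁺ ≡ value μ ℤ.+ 1ℤ

Raisable≥0 : ∀ {p} → Decorated p → Set
Raisable≥0 x = 0 < raisability x × (∃[ t ] modality x ≡ +ₘ t)

Raisable₋₁ : ∀ {p} → Decorated p → Set
Raisable₋₁ x = 0 < raisability x × modality x ≡ -1ₘ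

-- A factor (μ)^{j,-1} w of the factorization used for the steps (-m, p-m), m ≥ 1.
record Block (p : ℕ) : Set where
  constructor block
  field
    μ          : Symbol p
    j          : ℕ
    w          : List (Decorated p)
    j>0        : 0 < j
    w-inactive : All (λ x → ¬ Raisable₋₁ x) w

before after : ∀ {p} → Block p → List (Decorated p)
before (block μ j w _ _) = deco μ j -1ₘ ∷ w
after  (block μ _ w _ _) = deco μ 0 -1ₘ ∷ w

-- RaiseStep L s L′: from L = L_{i-1} and the step s, the algorithm can produce
-- L′ = L_i.  The factorizations are hypotheses, and a letter can only be
-- raised within Σ_p.
data RaiseStep {p : ℕ} (L : List (Decorated p)) : Step p → List (Decorated p) → Set where
  stepA : RaiseStep L (nw 0 z≤n) (L ++ [ deco (nat 0 z≤n) p (+ₘ 0) ])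

  stepB₀ : ∀ {w w′ μ μ⁺ j} →
    L ≡ w ++ deco μ (suc j) (+ₘ 0) ∷ w′ →
    All (λ x → ¬ Raisable≥0 x) w′ →
    μ⁺ isSuccOf μ →
    RaiseStep L se (w ++ deco μ⁺ j (+ₘ 0) ∷ w′ ++ [ deco minus 1 -1ₘ ])

  stepB₊ : ∀ {w″ w‴ w′ μ′ μ′⁺ μ j t} →
    L ≡ w″ ++ deco μ′ 0 -1ₘ ∷ w‴ ++ deco μ (suc j) (+ₘ suc t) ∷ w′ →
    All (λ x → ¬ Raisable≥0 x) w′ →
    length w‴ ≡ t →
    μ′⁺ isSuccOf μ′ →
    RaiseStep L se
      (w″ ++ deco μ′⁺ 0 -1ₘ ∷ w‴ ++ deco μ j (+ₘ suc t) ∷ w′ ++ [ deco minus 1 -1ₘ ])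

  -- |L| = i - 1, so the new modality is i - 1 - |w₀|.
  stepC : ∀ {m w₀ μ₁⁺} .{m<p : suc m ≤ p} (b₁ : Block p) (bs : List (Block p)) →
    length bs ≡ m →
    L ≡ w₀ ++ before b₁ ++ concatMap before bs →
    μ₁⁺ isSuccOf Block.μ b₁ →
    RaiseStep L (nw (suc m) m<p)
      (w₀ ++ (deco μ₁⁺ 0 -1ₘ ∷ Block.w b₁) ++ concatMap after bs
          ++ [ deco minus (p ∸ suc m) (+ₘ (length L ∸ length w₀)) ])

data RaiseSteps {p : ℕ} : List (Decorated p) → List (Step p) → List (Decorated p) → Set where
  done : ∀ {L} → RaiseSteps L [] L
  next : ∀ {L L′ L″ s w} → RaiseStep L s L′ → RaiseSteps L′ w L″ → RaiseSteps L (s ∷ w) L″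

RaisingOutput : ∀ {p} → List (Step p) → List (Symbol p) → Set
RaisingOutput w u = ∃[ L ] RaiseSteps [] w L × u ≡ map symbol L

{-# OPTIONS --safe #-}

-- The transducer run on a prefix from an arbitrary configuration (Λ , v) produces the
-- output for that prefix when v steps (1,-1) and the steps stored in Λ still await their
-- partners in it.  Each output letter carries a raisability and a modality that can be
-- read off such a run: the raisability of a step (-j, p-j) is what remains of p - j after
-- it has absorbed part of v, and its modality is the distance to the earlier step (1,-1)
-- at which its own stored letter is popped.  Appending a step s to a prefix starts the
-- run on the prefix at back ([] , 0) s instead of ([] , 0).  For s = (1,-1), increasing
-- v by 1 changes nothing up to the last step with spare capacity, which then passes the
-- increase on to exactly one output letter; for s = (-m, p-m) with m ≥ 1, the extra
-- letter at the bottom of the stack is met by the last m steps (1,-1) that are still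
-- free.  These are the raising rules, and their factorizations are unique.
module Submission where

open import Defs
open import Data.Integer.Base as ℤ using (+_; 0ℤ)
import Data.Integer.Properties as ℤ
open import Data.List.Base
  using (List; []; _∷_; _++_; [_]; length; map; concatMap; filter; reverse; _ʳ++_)
open import Data.List.Properties
  using (++-assoc; ++-identityʳ; ∷-injective; ∷-injectiveˡ; ∷-injectiveʳ; length-++;
         filter-++; filter-none; filter-accept; reverse-involutive; ʳ++-defn)
open import Data.List.Relation.Unary.All using (All; []; _∷_)
open import Data.List.Relation.Unary.All.Properties using (++⁻ʳ)
open import Data.Nat.Base using (ℕ; zero; suc; _+_; _∸_; _⊓_; _≤_; _<_; z≤n; s≤s)
open import Data.Nat.Properties
open import Data.Product.Base using (_×_; _,_; ∃-syntax; proj₁; proj₂; map₁)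
open import Data.Sum.Base using (_⊎_; inj₁; inj₂)
open import Relation.Binary.PropositionalEquality
  using (_≡_; refl; sym; trans; cong; cong₂; subst)
open import Relation.Nullary using (¬_; Dec; yes; no; contradiction)
open import Relation.Nullary.Decidable using (recompute; _×-dec_)

private variable
  p : ℕ

-- Truncated arithmetic for the transducer.

capped-bound : ∀ v m → suc m ≤ p → v ⊓ (p ∸ suc m) + m < p
capped-bound {p} v m c =
  ≤-trans (≤-reflexive (sym (+-suc (v ⊓ (p ∸ suc m)) m)))
  (≤-trans (+-monoˡ-≤ (suc m) (m⊓n≤n v (p ∸ suc m))) (≤-reflexive (m∸n+n≡m c)))

nat-cong : ∀ {k l} .{x : k ≤ p} .{y : l ≤ p} → k ≡ l → nat {p} k x ≡ nat l y
nat-cong refl = refl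

a-cong : ∀ {k l m} .{x : k + m < p} .{y : l + m < p} → k ≡ l → a {p} k m x ≡ a l m y
a-cong refl = refl

-- The case distinctions of `back` on the steps (-j, p-j) become arithmetic:
-- such a step absorbs the amount v ⊓ (p ∸ j) and passes on the rest.
back′ : Config p → Step p → Symbol p × Config p
back′ {p} (Λ , v) (nw zero _)    = nat (v ⊓ p) (m⊓n≤n v p) , Λ , v ∸ p
back′ {p} (Λ , v) (nw (suc m) c) =
  minus , a (v ⊓ (p ∸ suc m)) m (capped-bound v m c) ∷ Λ , v ∸ (p ∸ suc m)
back′     c       se             = back c se

back≡back′ : ∀ (c : Config p) s → back c s ≡ back′ c s
back≡back′ {p} (Λ , v) (nw zero _) with p ≤? v
... | yes p≤v = cong (λ x → x , Λ , v ∸ p) (nat-cong (sym (m≥n⇒m⊓n≡n p≤v)))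
... | no p≰v  = cong₂ (λ x y → x , Λ , y) (nat-cong (sym (m≤n⇒m⊓n≡m (≰⇒≥ p≰v))))
                  (sym (m≤n⇒m∸n≡0 (≰⇒≥ p≰v)))
back≡back′ {p} (Λ , v) (nw (suc m) c) with v + m <? p
... | yes b = cong₂ (λ x y → minus , x ∷ Λ , y) (a-cong (sym (m≤n⇒m⊓n≡m v≤)))
                (sym (m≤n⇒m∸n≡0 v≤))
  where
  v≤ : v ≤ p ∸ suc m
  v≤ = m+n≤o⇒m≤o∸n v (≤-trans (≤-reflexive (+-suc v m)) b)
... | no ¬b = cong (λ x → minus , x ∷ Λ , v ∸ (p ∸ suc m)) (a-cong (sym (m≥n⇒m⊓n≡n ≤v)))
  where
  ≤v : p ∸ suc m ≤ v
  ≤v = m≤n+o⇒m∸n≤o p (suc m) (≤-trans (≮⇒≥ ¬b)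
         (≤-trans (≤-reflexive (+-comm v m)) (n≤1+n (m + v))))
back≡back′ c se = refl

-- Decorations read off a transducer run.

-- From here on, prefixes are reversed (last step first), as the transducer reads them.

-- The number of steps read before the one that meets the (n+1)-st pending
-- request for a step (1,-1), where each (-j, p-j) adds j requests.
skip : List (Step p) → ℕ → ℕ
skip []           n       = 0
skip (nw j _ ∷ r) n       = suc (skip r (j + n))
skip (se ∷ r)     zero    = 0
skip (se ∷ r)     (suc n) = suc (skip r n)

-- A letter `a ℓ m` takes `m` steps (1,-1) to lower its second index to 0 and one more to be popped;
-- `n` carries the need of a letter lying below `Λ`.
requests : List (Stored p) → ℕ → ℕ
requests []            n = n
requests (a _ m _ ∷ Λ) n = suc (m + requests Λ n)

decorate : List (Step p) → Config p → Step p → Decorated p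
decorate {p} r c@(_ , v)     s@(nw zero _)    = deco (proj₁ (back′ c s)) (p ∸ v) (+ₘ 0)
decorate {p} r c@(_ , v)     s@(nw (suc m) _) =
  deco minus (p ∸ suc m ∸ v) (+ₘ suc (skip r m))
-- Only a step (1,-1) that finds the stack empty is free to serve a letter stored by a step appended
-- afterwards, hence raisability 1.
decorate     r c@([] , _)    se               = deco minus 1 -1ₘ
decorate     r c@(_ ∷ _ , _) se               = deco (proj₁ (back c se)) 0 -1ₘ

decorations : List (Step p) → Config p → List (Decorated p) → List (Decorated p)
decorations []      c acc = acc
decorations (s ∷ r) c acc = decorations r (proj₂ (back′ c s)) (decorate r c s ∷ acc)

decorations-++ : ∀ (r : List (Step p)) c acc →
                 decorations r c acc ≡ decorations r c [] ++ acc
decorations-++ []      c acc = refl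
decorations-++ (s ∷ r) c acc =
  trans (decorations-++ r _ _)
  (trans (sym (++-assoc (decorations r _ []) [ decorate r c s ] acc))
         (cong (_++ acc) (sym (decorations-++ r _ _))))

symbol-decorate : ∀ (r : List (Step p)) c s → symbol (decorate r c s) ≡ proj₁ (back′ c s)
symbol-decorate r c           (nw zero _)    = refl
symbol-decorate r c           (nw (suc m) _) = refl
symbol-decorate r ([] , v)    se             = refl
symbol-decorate r (_ ∷ _ , v) se             = refl

symbols-decorations : ∀ (r : List (Step p)) v acc → map symbol acc ≡ Ψ v →
  map symbol (decorations r (proj₂ (runRL v)) acc) ≡ Ψ (r ʳ++ v)
symbols-decorations []      v acc eq = eq
symbols-decorations (s ∷ r) v acc eq
  rewrite sym (back≡back′ (proj₂ (runRL v)) s) =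
  symbols-decorations r (s ∷ v) _
    (cong₂ _∷_ (trans (symbol-decorate r c s) (cong proj₁ (sym (back≡back′ c s)))) eq)
  where c = proj₂ (runRL v)

-- Quarter-plane walks, built step by step.

-- The premise indices `j + x` and `suc y` encode staying in the quadrant. At `start` both
-- coordinates are 0, which refutes the strict bounds by `x` or `y` carried through the later
-- inductions.
data Reaches {p} : List (Step p) → ℕ → ℕ → Set where
  start : Reaches [] 0 0
  west  : ∀ {r x y j} .{j≤p : j ≤ p} →
          Reaches r (j + x) y → Reaches (nw j j≤p ∷ r) x (y + (p ∸ j))
  east  : ∀ {r x y} → Reaches r x (suc y) → Reaches (se ∷ r) (suc x) y

StaysIn : ℕ → ℕ → List (Step p) → Set
StaysIn x y w = ∀ u v → w ≡ u ++ v → InQuadrant ((+ x , + y) ⊕ endpoint u)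

⊕-assoc : ∀ e f g → (e ⊕ f) ⊕ g ≡ e ⊕ (f ⊕ g)
⊕-assoc (x , y) (x′ , y′) (x″ , y″) = cong₂ _,_ (ℤ.+-assoc x x′ x″) (ℤ.+-assoc y y′ y″)

⊕-identityʳ : ∀ e → e ⊕ (0ℤ , 0ℤ) ≡ e
⊕-identityʳ (x , y) = cong₂ _,_ (ℤ.+-identityʳ x) (ℤ.+-identityʳ y)

⊕-identityˡ : ∀ e → (0ℤ , 0ℤ) ⊕ e ≡ e
⊕-identityˡ (x , y) = cong₂ _,_ (ℤ.+-identityˡ x) (ℤ.+-identityˡ y)

reaches-step : ∀ {r x y} (s : Step p) → Reaches r x y → InQuadrant ((+ x , + y) ⊕ vec s) →
  ∃[ x′ ] ∃[ y′ ] Reaches (s ∷ r) x′ y′ × (+ x , + y) ⊕ vec s ≡ (+ x′ , + y′)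
reaches-step {p} {r} {x} {y} (nw j j≤p) ρ (0≤x , _) =
  x ∸ j , y + (p ∸ j) ,
  west (subst (λ z → Reaches r z y) (sym (m+[n∸m]≡n j≤x)) ρ) ,
  cong₂ _,_ (difference j≤x)
    (cong (λ z → + y ℤ.+ z) (difference (recompute (j ≤? p) j≤p)))
  where
  difference : ∀ {k l} → l ≤ k → + k ℤ.- + l ≡ + (k ∸ l)
  difference {k} {l} l≤k = trans (ℤ.m-n≡m⊖n k l) (ℤ.⊖-≥ l≤k)
  j≤x : j ≤ x
  j≤x = ℤ.drop‿+≤+ (ℤ.0≤i-j⇒j≤i 0≤x)
reaches-step {x = x} {zero}  se ρ (_ , ())
reaches-step {x = x} {suc y} se ρ _ = suc x , y , east ρ , cong (λ z → + z , + y) (+-comm x 1)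

staysIn-step : ∀ {x y x′ y′} {s : Step p} {w} →
  (+ x , + y) ⊕ vec s ≡ (+ x′ , + y′) → StaysIn x y (s ∷ w) → StaysIn x′ y′ w
staysIn-step {x = x} {y} {s = s} eq σ u v w≡ =
  subst InQuadrant
    (trans (sym (⊕-assoc (+ x , + y) (vec s) (endpoint u))) (cong (_⊕ endpoint u) eq))
    (σ (s ∷ u) v (cong (s ∷_) w≡))

-- Effect of appending a step (1,-1).

-- The letter a_{k,m} below Λ₁ is visible in the output at one place only.
locate : ∀ {r : List (Step p)} {x y} → Reaches r x y → ∀ Λ₁ {m} Λ v acc →
  requests Λ₁ m < x →
  ∃[ w″ ] ∃[ w‴ ] length w‴ ≡ skip r (requests Λ₁ m) + length acc ×
    (∀ k .(b : k + m < p) .(k≤p : k ≤ p) →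
      decorations r (Λ₁ ++ a k m b ∷ Λ , v) acc ≡ w″ ++ deco (nat k k≤p) 0 -1ₘ ∷ w‴)
locate start Λ₁ Λ v acc ()
locate (west {r} {x} {j = zero} {j≤p} ρ) Λ₁ Λ v acc d
  with w″ , w‴ , len , eq ← locate ρ Λ₁ Λ _ (_ ∷ acc) d =
  w″ , w‴ , trans len (+-suc _ _) , eq
-- Storing a letter adds `suc j` to both sides of the bound.
locate (west {j = suc j} ρ) Λ₁ Λ v acc d
  with w″ , w‴ , len , eq ← locate ρ (_ ∷ Λ₁) Λ _ (_ ∷ acc)
         (s≤s (≤-trans (≤-reflexive (sym (+-suc j _))) (+-monoʳ-≤ j d))) =
  w″ , w‴ , trans len (+-suc _ _) , eq
-- The pop by T5 outputs `k`, and no other letter depends on `k`. As `w″` and `w‴` are chosen before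
-- `k`, two values of `k` can be compared.
locate (east {r} ρ) [] {zero} Λ v acc d =
  decorations r (Λ , suc v) [] , acc , refl , λ k b k≤p → decorations-++ r _ _
locate (east ρ) [] {suc m} Λ v acc (s≤s d)
  with w″ , w‴ , len , eq ← locate ρ [] Λ (suc v) (deco minus 0 -1ₘ ∷ acc) d =
  w″ , w‴ , trans len (+-suc _ _) ,
  λ k b k≤p → eq k (≤-<-trans (+-monoʳ-≤ k (n≤1+n m)) b) k≤p
locate (east ρ) (a q zero b ∷ Λ₁) Λ v acc (s≤s d)
  with w″ , w‴ , len , eq ← locate ρ Λ₁ Λ (suc v) (_ ∷ acc) d =
  w″ , w‴ , trans len (+-suc _ _) , eq
locate (east ρ) (a q (suc n) b ∷ Λ₁) Λ v acc (s≤s d)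
  with w″ , w‴ , len , eq ← locate ρ (a q n _ ∷ Λ₁) Λ (suc v) (_ ∷ acc) d =
  w″ , w‴ , trans len (+-suc _ _) , eq

-- If `v < cap`, a unit increase of `v` is absorbed at the cost of one unit of raisability;
-- otherwise the step is full and passes it on.
raise-value : ∀ v cap →
  (cap ∸ v ≡ suc (cap ∸ suc v) × suc v ⊓ cap ≡ suc (v ⊓ cap) × suc v ∸ cap ≡ v ∸ cap) ⊎
  (cap ∸ v ≡ 0 × cap ∸ suc v ≡ 0 × suc v ⊓ cap ≡ v ⊓ cap × suc v ∸ cap ≡ suc (v ∸ cap))
raise-value v cap with cap ≤? v
... | yes cap≤v = inj₂
  ( m≤n⇒m∸n≡0 cap≤v , m≤n⇒m∸n≡0 (m≤n⇒m≤1+n cap≤v)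
  , trans (m≥n⇒m⊓n≡n (m≤n⇒m≤1+n cap≤v)) (sym (m≥n⇒m⊓n≡n cap≤v)) , +-∸-assoc 1 cap≤v )
... | no cap≰v = inj₁
  ( sym (suc[m]∸suc[n] (≰⇒> cap≰v))
  , trans (m≤n⇒m⊓n≡m (≰⇒> cap≰v)) (cong suc (sym (m≤n⇒m⊓n≡m (≰⇒≥ cap≰v))))
  , trans (m≤n⇒m∸n≡0 (≰⇒> cap≰v)) (sym (m≤n⇒m∸n≡0 (≰⇒≥ cap≰v))) )
  where
  suc[m]∸suc[n] : ∀ {m n} → m < n → suc (n ∸ suc m) ≡ n ∸ m
  suc[m]∸suc[n] {m} {suc n} (s≤s m≤n) = sym (+-∸-assoc 1 m≤n)

isSuccOf-nat : ∀ k .(x : suc k ≤ p) .(y : k ≤ p) → nat {p} (suc k) x isSuccOf nat k y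
isSuccOf-nat k _ _ = cong +_ (+-comm 1 k)

pass-on-bound : ∀ {v y} cap → suc v ∸ cap ≡ suc (v ∸ cap) → v < y + cap → v ∸ cap < y
pass-on-bound {v} {y} cap eq d =
  ≤-trans (≤-reflexive (sym eq))
          (m≤n+o⇒m∸n≤o (suc v) cap (≤-trans d (≤-reflexive (+-comm y cap))))

-- The increase travels leftwards past full steps, whose raisability is 0, so its absorber is the
-- last letter eligible for raising. One exists because `v < y` persists: a full step takes its
-- capacity off both sides, a step (1,-1) adds 1 to both.
raise-y : ∀ {r : List (Step p)} {x y} → Reaches r x y → ∀ Λ v acc → v < y →
  All (λ d → ¬ Raisable≥0 d) acc →
  RaiseStep (decorations r (Λ , v) acc) se
            (decorations r (Λ , suc v) (acc ++ [ deco minus 1 -1ₘ ]))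
raise-y start Λ v acc () _
raise-y {p} (west {r} {x} {y} {zero} ρ) Λ v acc d inactive with raise-value v p
... | inj₁ (j≡ , k≡ , v≡) =
  subst (RaiseStep _ se) (sym eq′)
    (stepB₀ eq inactive (isSuccOf-nat (v ⊓ p) bound (m⊓n≤n v p)))
  where
  L = decorations r (Λ , v ∸ p) []
  bound : suc (v ⊓ p) ≤ p
  bound = ≤-trans (≤-reflexive (sym k≡)) (m⊓n≤n (suc v) p)
  eq : decorations r (Λ , v ∸ p)
         (deco (nat (v ⊓ p) (m⊓n≤n v p)) (p ∸ v) (+ₘ 0) ∷ acc)
       ≡ L ++ deco (nat (v ⊓ p) (m⊓n≤n v p)) (suc (p ∸ suc v)) (+ₘ 0) ∷ acc
  eq = trans (decorations-++ r _ _)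
         (cong (λ j → L ++ deco (nat (v ⊓ p) (m⊓n≤n v p)) j (+ₘ 0) ∷ acc) j≡)
  acc⁺ = acc ++ [ deco minus 1 -1ₘ ]
  eq′ : decorations r (Λ , suc v ∸ p)
          (deco (nat (suc v ⊓ p) (m⊓n≤n (suc v) p)) (p ∸ suc v) (+ₘ 0) ∷ acc⁺)
        ≡ L ++ deco (nat (suc (v ⊓ p)) bound) (p ∸ suc v) (+ₘ 0) ∷ acc⁺
  eq′ = trans (decorations-++ r _ _)
          (cong₂ (λ z μ → decorations r (Λ , z) [] ++ deco μ (p ∸ suc v) (+ₘ 0) ∷ acc⁺)
                 v≡ (nat-cong k≡))
... | inj₂ (j≡ , j⁺≡ , k≡ , v≡) =
  subst (RaiseStep _ se)
    (cong₂ (λ z d′ → decorations r (Λ , z) (d′ ∷ acc ++ [ deco minus 1 -1ₘ ])) (sym v≡)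
      (cong₂ (λ μ j → deco μ j (+ₘ 0)) (nat-cong (sym k≡)) (trans j≡ (sym j⁺≡))))
    (raise-y ρ Λ (v ∸ p) _ (pass-on-bound p v≡ d)
      ((λ (j>0 , _) → <-irrefl (sym j≡) j>0) ∷ inactive))
raise-y {p} (west {r} {x} {y} {suc m} {m<p} ρ) Λ v acc d inactive with raise-value v (p ∸ suc m)
... | inj₁ (j≡ , k≡ , v≡)
  -- The fresh letter is on top and `ρ` ends at abscissa `suc m + x`, more than its `m` requests, so
  -- its pop occurs in `r`.
  with w″ , w‴ , len , located ← locate ρ [] Λ (v ∸ (p ∸ suc m)) [] (s≤s (m≤m+n m x)) =
  subst (RaiseStep _ se) (sym eq′)
    (stepB₊ {μ = minus} {j = cap ∸ suc v}
      eq inactive (trans len (+-identityʳ (skip r m)))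
      (isSuccOf-nat (v ⊓ cap) bound (k≤ v)))
  where
  cap = p ∸ suc m
  k≤ : ∀ v → v ⊓ cap ≤ p
  k≤ v = ≤-trans (m⊓n≤n v cap) (m∸n≤m p (suc m))
  split : ∀ k .(b : k + m < p) .(k≤p : k ≤ p) acc →
    decorations r (a k m b ∷ Λ , v ∸ cap) acc ≡ w″ ++ deco (nat k k≤p) 0 -1ₘ ∷ w‴ ++ acc
  split k b k≤p acc = trans (decorations-++ r _ acc)
    (trans (cong (_++ acc) (located k b k≤p)) (++-assoc w″ _ acc))
  eq : decorations r (a (v ⊓ cap) m (capped-bound v m m<p) ∷ Λ , v ∸ cap)
         (deco minus (cap ∸ v) (+ₘ suc (skip r m)) ∷ acc)
       ≡ w″ ++ deco (nat (v ⊓ cap) (k≤ v)) 0 -1ₘ ∷ w‴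
           ++ deco minus (suc (cap ∸ suc v)) (+ₘ suc (skip r m)) ∷ acc
  eq = trans (split (v ⊓ cap) (capped-bound v m m<p) (k≤ v) _)
         (cong (λ j → w″ ++ deco (nat (v ⊓ cap) (k≤ v)) 0 -1ₘ ∷ w‴
                        ++ deco minus j (+ₘ suc (skip r m)) ∷ acc) j≡)
  acc⁺ = deco minus (cap ∸ suc v) (+ₘ suc (skip r m)) ∷ acc ++ [ deco minus 1 -1ₘ ]
  bound : suc (v ⊓ cap) ≤ p
  bound = subst (_≤ p) k≡ (k≤ (suc v))
  eq′ : decorations r (a (suc v ⊓ cap) m (capped-bound (suc v) m m<p) ∷ Λ , suc v ∸ cap) acc⁺
        ≡ w″ ++ deco (nat (suc (v ⊓ cap)) bound) 0 -1ₘ ∷ w‴ ++ acc⁺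
  eq′ = trans
    (cong (λ z → decorations r (a (suc v ⊓ cap) m (capped-bound (suc v) m m<p) ∷ Λ , z) acc⁺) v≡)
    (trans (split (suc v ⊓ cap) (capped-bound (suc v) m m<p) (k≤ (suc v)) acc⁺)
           (cong (λ μ → w″ ++ deco μ 0 -1ₘ ∷ w‴ ++ acc⁺) (nat-cong k≡)))
... | inj₂ (j≡ , j⁺≡ , k≡ , v≡) =
  subst (RaiseStep _ se)
    (trans (cong₂ (λ z l → result z l (cap ∸ v)) (sym v≡) (a-cong (sym k≡)))
           (cong (result (suc v ∸ cap) (a (suc v ⊓ cap) m (capped-bound (suc v) m m<p)))
                 (trans j≡ (sym j⁺≡))))
    (raise-y ρ (_ ∷ Λ) (v ∸ (p ∸ suc m)) _ (pass-on-bound (p ∸ suc m) v≡ d)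
      ((λ (j>0 , _) → <-irrefl (sym j≡) j>0) ∷ inactive))
  where
  cap = p ∸ suc m
  result : ℕ → Stored p → ℕ → List (Decorated p)
  result z l j = decorations r (l ∷ Λ , z)
    (deco minus j (+ₘ suc (skip r m)) ∷ acc ++ [ deco minus 1 -1ₘ ])
raise-y (east ρ) []                  v acc d inactive =
  raise-y ρ [] (suc v) _ (s≤s d) ((λ { (_ , _ , ()) }) ∷ inactive)
raise-y (east ρ) (a q zero _ ∷ Λ)    v acc d inactive =
  raise-y ρ Λ (suc v) _ (s≤s d) ((λ { (_ , _ , ()) }) ∷ inactive)
raise-y (east ρ) (a q (suc m) _ ∷ Λ) v acc d inactive =
  raise-y ρ (_ ∷ Λ) (suc v) _ (s≤s d) ((λ { (_ , _ , ()) }) ∷ inactive)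

-- Effect of appending a step (-m-1, p-m-1).

-- The factorization for a step (-m-1, p-m-1) is found from right to left: w bs is
-- the part already read, still lacking the beginning of the factor w and m more blocks.
record Raising (m skipped : ℕ) (w : List (Decorated p)) (bs : List (Block p))
               (L L′ : List (Decorated p)) : Set where
  field
    w₀      : List (Decorated p)
    b       : Block p
    blocks  : List (Block p)
    μ⁺      : Symbol p
    size    : length blocks ≡ m + length bs
    L≡      : L ≡ w₀ ++ before b ++ concatMap before blocks
    succ    : μ⁺ isSuccOf Block.μ b
    L′≡     : L′ ≡ w₀ ++ (deco μ⁺ 0 -1ₘ ∷ Block.w b) ++ concatMap after blocks
    offset  : length (before b ++ concatMap before blocks)
              ≡ suc (skipped + length (w ++ concatMap before bs))

-- Consider the steps (1,-1) that find the stack empty in the run without the bottom letter. With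
-- it, the first `m` of them still output -1 but lose their raisability, and the next one pops it
-- and outputs 0; then the runs coincide.
raise-x : ∀ {r : List (Step p)} {x y} → Reaches r x y → ∀ Λ {m} .(m<p : m < p) v w bs →
  All (λ d → ¬ Raisable₋₁ d) w → requests Λ m < x →
  Raising m (skip r (requests Λ m)) w bs
    (decorations r (Λ , v) (w ++ concatMap before bs))
    (decorations r (Λ ++ [ a 0 m m<p ] , v) (w ++ concatMap after bs))
raise-x start Λ m<p v w bs i ()
raise-x (west {j = zero} ρ) Λ m<p v w bs i d =
  -- The letter just read leaves `skipped` and joins `w`.
  record { Raising R ; offset = trans (Raising.offset R) (cong suc (+-suc _ _)) }
  where R = raise-x ρ Λ m<p _ (_ ∷ w) bs ((λ { (_ , ()) }) ∷ i) d
raise-x (west {j = suc j} ρ) Λ m<p v w bs i d =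
  record { Raising R ; offset = trans (Raising.offset R) (cong suc (+-suc _ _)) }
  where
  R = raise-x ρ (_ ∷ Λ) m<p _ (_ ∷ w) bs ((λ { (_ , ()) }) ∷ i)
        (s≤s (≤-trans (≤-reflexive (sym (+-suc j _))) (+-monoʳ-≤ j d)))
raise-x (east {r} ρ) [] {zero} m<p v w bs i d = record
  { w₀ = decorations r ([] , suc v) []
  ; b  = block minus 1 w (s≤s z≤n) i
  ; blocks = bs
  ; μ⁺ = nat 0 z≤n
  ; size = refl
  ; L≡ = decorations-++ r _ _
  ; succ = refl
  ; L′≡ = decorations-++ r _ _
  ; offset = refl
  }
-- T6 replaces T7 here: this letter closes `w` into a block, and a new inactive factor starts empty.
raise-x (east ρ) [] {suc m} m<p v w bs i (s≤s d) =
  record { Raising R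
         ; size   = trans (Raising.size R) (+-suc m (length bs))
         ; offset = trans (Raising.offset R) (cong suc (+-suc _ _)) }
  where R = raise-x ρ [] (<⇒≤ m<p) (suc v) [] (block minus 1 w (s≤s z≤n) i ∷ bs) [] d
raise-x (east ρ) (a q zero _ ∷ Λ) m<p v w bs i (s≤s d) =
  record { Raising R ; offset = trans (Raising.offset R) (cong suc (+-suc _ _)) }
  where R = raise-x ρ Λ m<p (suc v) (_ ∷ w) bs ((λ { (() , _) }) ∷ i) d
raise-x (east ρ) (a q (suc n) _ ∷ Λ) m<p v w bs i (s≤s d) =
  record { Raising R ; offset = trans (Raising.offset R) (cong suc (+-suc _ _)) }
  where R = raise-x ρ (_ ∷ Λ) m<p (suc v) (_ ∷ w) bs ((λ { (() , _) }) ∷ i) d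

-- The decorated words form a run of the raising algorithm.

module _ {p : ℕ} where

  raised : List (Step p) → List (Decorated p)
  raised r = decorations r ([] , 0) []

  raised-step : ∀ {r x y} s → Reaches (s ∷ r) x y → RaiseStep (raised r) s (raised (s ∷ r))
  raised-step {r} (nw zero _) _ = subst (RaiseStep (raised r) _) (sym eq) stepA
    where
    eq : raised (nw 0 z≤n ∷ r) ≡ raised r ++ [ deco (nat 0 z≤n) p (+ₘ 0) ]
    eq = trans (cong (λ v → decorations r ([] , v) [ deco (nat 0 z≤n) p (+ₘ 0) ]) (0∸n≡0 p))
               (decorations-++ r _ _)
  raised-step {r} {x} (nw (suc m) m<p) (west ρ) =
    subst (RaiseStep (raised r) _) (sym eq) (stepC b blocks (trans size (+-identityʳ m)) L≡ succ)
    where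
    open Raising (raise-x ρ [] m<p 0 [] [] [] (s≤s (m≤m+n m x)))
    -- The distance to the pop is the modality i-1-|w₀| of the rule.
    modality≡ : suc (skip r m) ≡ length (raised r) ∸ length w₀
    modality≡ = sym (trans (cong (λ L → length L ∸ length w₀) L≡)
      (trans (cong (_∸ length w₀) (length-++ w₀))
      (trans (m+n∸m≡n (length w₀) _)
      (trans offset (cong suc (+-identityʳ (skip r m)))))))
    new : ℕ → List (Decorated p)
    new t = [ deco minus (p ∸ suc m) (+ₘ t) ]
    raised-block = deco μ⁺ 0 -1ₘ ∷ Block.w b
    eq : raised (nw (suc m) m<p ∷ r) ≡ w₀ ++ raised-block ++ concatMap after blocks
                                          ++ new (length (raised r) ∸ length w₀)
    eq = trans (cong (λ v → decorations r ([ a 0 m m<p ] , v) (new (suc (skip r m))))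
                     (0∸n≡0 (p ∸ suc m)))
      (trans (decorations-++ r _ _)
      (trans (cong₂ _++_ L′≡ (cong new modality≡))
      (trans (++-assoc w₀ (raised-block ++ concatMap after blocks) _)
             (cong (w₀ ++_) (++-assoc raised-block (concatMap after blocks) _)))))
  -- Reading the new step first turns `([] , 0)` into `([] , 1)`.
  raised-step se (east ρ) = raise-y ρ [] 0 [] (s≤s z≤n) []

  raised-steps : ∀ {r x y} → Reaches r x y → ∀ w → StaysIn x y w →
                 RaiseSteps (raised r) w (raised (w ʳ++ r))
  raised-steps ρ []      _ = done
  raised-steps {x = x} {y} ρ (s ∷ w) σ
    with reaches-step s ρ (subst (λ e → InQuadrant ((+ x , + y) ⊕ e)) (⊕-identityʳ (vec s))
                                 (σ [ s ] w refl))
  ... | x′ , y′ , ρ′ , eq = next (raised-step s ρ′) (raised-steps ρ′ w (staysIn-step eq σ))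

-- Uniqueness of the factorizations.

value-injective : ∀ {μ ν : Symbol p} → value μ ≡ value ν → μ ≡ ν
value-injective {μ = minus}   {minus}    _    = refl
value-injective {μ = nat q _} {nat .q _} refl = refl

isSuccOf-unique : ∀ {μ μ⁺ ν ν⁺ : Symbol p} → μ ≡ ν → μ⁺ isSuccOf μ → ν⁺ isSuccOf ν → μ⁺ ≡ ν⁺
isSuccOf-unique {μ = μ} refl s s′ = value-injective (trans s (sym s′))

split-at-last : ∀ {A : Set} {P : A → Set} w v {x y : A} {w′ v′} →
  w ++ x ∷ w′ ≡ v ++ y ∷ v′ → P x → P y → All (λ z → ¬ P z) w′ → All (λ z → ¬ P z) v′ →
  w ≡ v × x ≡ y × w′ ≡ v′
split-at-last []      []      refl px py iw iv = refl , refl , refl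
split-at-last []      (z ∷ v) refl px py iw iv with ++⁻ʳ v iw
... | ¬py ∷ _ = contradiction py ¬py
split-at-last (z ∷ w) []      refl px py iw iv with ++⁻ʳ w iv
... | ¬px ∷ _ = contradiction px ¬px
split-at-last (z ∷ w) (z′ ∷ v) eq px py iw iv
  with refl , eq′ ← ∷-injective eq
  with refl , rest ← split-at-last w v eq′ px py iw iv = refl , rest

split-at-length : ∀ {A : Set} (w v : List A) {w′ v′} →
  w ++ w′ ≡ v ++ v′ → length w′ ≡ length v′ → w ≡ v × w′ ≡ v′
split-at-length []      []      eq   _   = refl , eq
split-at-length []      (z ∷ v) refl len =
  contradiction (trans (sym len) (cong suc (length-++ v))) (m≢1+n+m _)
split-at-length (z ∷ w) []      refl len =
  contradiction (trans len (cong suc (length-++ w))) (m≢1+n+m _)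
split-at-length (z ∷ w) (z′ ∷ v) eq len
  with refl , eq′ ← ∷-injective eq
  with refl , rest ← split-at-length w v eq′ len = refl , rest

raisable₋₁? : (x : Decorated p) → Dec (Raisable₋₁ x)
raisable₋₁? (deco _ j t) = (0 <? j) ×-dec is-1? t
  where
  is-1? : ∀ t → Dec (t ≡ -1ₘ)
  is-1? -1ₘ    = yes refl
  is-1? (+ₘ _) = no λ ()

count₋₁ : List (Decorated p) → ℕ
count₋₁ w = length (filter raisable₋₁? w)

count₋₁-++ : ∀ (w v : List (Decorated p)) → count₋₁ (w ++ v) ≡ count₋₁ w + count₋₁ v
count₋₁-++ w v =
  trans (cong length (filter-++ raisable₋₁? w v)) (length-++ (filter raisable₋₁? w))

count₋₁-raisable : ∀ {x : Decorated p} w → Raisable₋₁ x → count₋₁ (x ∷ w) ≡ suc (count₋₁ w)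
count₋₁-raisable w r = cong length (filter-accept raisable₋₁? r)

count₋₁-blocks : ∀ (bs : List (Block p)) → count₋₁ (concatMap before bs) ≡ length bs
count₋₁-blocks []                       = refl
count₋₁-blocks (block μ j w j>0 i ∷ bs) =
  trans (count₋₁-raisable (w ++ concatMap before bs) (j>0 , refl))
  (cong suc (trans (count₋₁-++ w _)
    (cong₂ _+_ (cong length (filter-none raisable₋₁? i)) (count₋₁-blocks bs))))

-- The letter `x` would be the head of `b`, hence raisable, so the right side would have more
-- raisable letters of modality -1 than the `length cs` on the left.
no-early-block : ∀ b x (v : List (Decorated p)) bs cs → length (b ∷ bs) ≡ length cs →
  ¬ (concatMap before (b ∷ bs) ≡ x ∷ v ++ concatMap before cs)
no-early-block b@(block _ _ _ j>0 _) x v bs cs len eq with refl ← ∷-injectiveˡ eq =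
  m≢1+n+m (length cs) (trans (sym len) (trans (sym (count₋₁-blocks (b ∷ bs)))
    (trans (cong count₋₁ eq)
    (trans (count₋₁-raisable (v ++ concatMap before cs) (j>0 , refl))
           (cong suc (trans (count₋₁-++ v _)
             (cong (λ n → count₋₁ v + n) (count₋₁-blocks cs))))))))

blocks-unique : ∀ (w v : List (Decorated p)) bs cs → length bs ≡ length cs →
  w ++ concatMap before bs ≡ v ++ concatMap before cs →
  w ≡ v × concatMap after bs ≡ concatMap after cs
blocks-unique w v [] [] len eq = trans (sym (++-identityʳ w)) (trans eq (++-identityʳ v)) , refl
blocks-unique [] [] (block μ j w _ _ ∷ bs) (block ν k v _ _ ∷ cs) len eq
  with refl , eq′ ← ∷-injective eq
  with refl , rest ← blocks-unique w v bs cs (suc-injective len) eq′ =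
  refl , cong (λ l → deco μ 0 -1ₘ ∷ w ++ l) rest
blocks-unique (x ∷ w) (y ∷ v) bs@(_ ∷ _) cs@(_ ∷ _) len eq =
  map₁ (cong₂ _∷_ (∷-injectiveˡ eq)) (blocks-unique w v bs cs len (∷-injectiveʳ eq))
blocks-unique [] (x ∷ v) (b ∷ bs) cs@(_ ∷ _) len eq =
  contradiction eq (no-early-block b x v bs cs len)
blocks-unique (x ∷ w) [] bs@(_ ∷ _) (c ∷ cs) len eq =
  contradiction (sym eq) (no-early-block c x w cs bs (sym len))

step-deterministic : ∀ {L L₁ L₂ : List (Decorated p)} {s} →
  RaiseStep L s L₁ → RaiseStep L s L₂ → L₁ ≡ L₂
step-deterministic stepA stepA = refl
step-deterministic (stepB₀ {w} {μ = μ} eq i s) (stepB₀ {v} eq′ i′ s′)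
  with refl , refl , refl ← split-at-last w v (trans (sym eq) eq′)
         (s≤s z≤n , _ , refl) (s≤s z≤n , _ , refl) i i′
  with refl ← isSuccOf-unique {μ = μ} refl s s′ = refl
-- The last eligible letter cannot have modality 0 and a positive modality at once.
step-deterministic (stepB₀ {w} eq i s) (stepB₊ {v} {v′} {μ′ = ν} eq′ i′ _ s′)
  with _ , () , _ ← split-at-last w (v ++ deco ν 0 -1ₘ ∷ v′)
         (trans (sym eq) (trans eq′ (sym (++-assoc v _ _))))
         (s≤s z≤n , _ , refl) (s≤s z≤n , _ , refl) i i′
step-deterministic (stepB₊ {w} {w′} {μ′ = μ} eq i _ s) (stepB₀ {v} eq′ i′ s′)
  with _ , () , _ ← split-at-last (w ++ deco μ 0 -1ₘ ∷ w′) v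
         (trans (++-assoc w _ _) (trans (sym eq) eq′))
         (s≤s z≤n , _ , refl) (s≤s z≤n , _ , refl) i i′
step-deterministic (stepB₊ {w} {w′} {μ′ = μ} eq i len s) (stepB₊ {v} {v′} {μ′ = ν} eq′ i′ len′ s′)
  with prefix≡ , refl , refl ← split-at-last (w ++ deco μ 0 -1ₘ ∷ w′) (v ++ deco ν 0 -1ₘ ∷ v′)
         (trans (++-assoc w _ _) (trans (sym eq) (trans eq′ (sym (++-assoc v _ _)))))
         (s≤s z≤n , _ , refl) (s≤s z≤n , _ , refl) i i′
  -- The `suc` counts the raised letter in front of `w‴`.
  with refl , refl ← split-at-length w v prefix≡ (cong suc (trans len (sym len′)))
  with refl ← isSuccOf-unique {μ = μ} refl s s′ = refl
step-deterministic {p} {L} (stepC {m} {w₀ = w} b@(block _ _ u _ _) bs len eq s)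
                           (stepC {w₀ = v} c@(block _ _ u′ _ _) cs len′ eq′ s′)
  with refl , rest ← blocks-unique w v (b ∷ bs) (c ∷ cs) (cong suc (trans len (sym len′)))
                       (trans (sym eq) eq′)
  with μ≡ , tail≡ ← ∷-injective rest =
  cong (w ++_) (cong₂ _∷_
    (cong (λ μ → deco μ 0 -1ₘ) (isSuccOf-unique (cong symbol μ≡) s s′))
    (trans (sym (++-assoc u (concatMap after bs) new))
    (trans (cong (_++ new) tail≡) (++-assoc u′ (concatMap after cs) new))))
  where new = [ deco minus (p ∸ suc m) (+ₘ (length L ∸ length w)) ]

steps-deterministic : ∀ {L L₁ L₂ : List (Decorated p)} {w} →
  RaiseSteps L w L₁ → RaiseSteps L w L₂ → L₁ ≡ L₂
steps-deterministic done       done = refl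
steps-deterministic (next s σ) (next s′ σ′)
  with refl ← step-deterministic s s′ = steps-deterministic σ σ′

theorem13 : (p : ℕ) → 1 ≤ p → (w : List (Step p)) → IsTandemWalk w →
    RaisingOutput w (Ψ w) × (∀ u → RaisingOutput w u → u ≡ Ψ w)
theorem13 p _ w walk =
  (L , run , sym symbols) ,
  λ { _ (L′ , run′ , refl) → trans (cong (map symbol) (steps-deterministic run′ run)) symbols }
  where
  L : List (Decorated p)
  L = raised (w ʳ++ [])
  run : RaiseSteps [] w L
  run = raised-steps start w (λ u v eq → subst InQuadrant (sym (⊕-identityˡ _)) (walk u v eq))
  symbols : map symbol L ≡ Ψ w
  symbols = trans (symbols-decorations (reverse w) [] [] refl)
                  (cong Ψ (trans (ʳ++-defn (reverse w))
                                 (trans (++-identityʳ _) (reverse-involutive w))))
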